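{- (1) For all integers $q \geq s \geq 2$, $R(s,q) \leq 2^{q-1}$, and for $s=2$ equality holds, i.e. $R(2,q)=2^{q-1}$ for all $q \ge 2$. (2) For every fixed integer $s \ge 2$, $R(s,q) \geq (2-o(1))^q$, where the $o(1)$-term tends to $0$ as $q \to \infty$; that is, for every $s\ge 2$ and $\delta>0$ there exists $q_0$ such that $R(s,q) \ge (2-\delta)^q$ for all $q \ge q_0$.
   Context: Let $Z_s$ be the ring of integers modulo $s$. For $A \subseteq Z_s$, a vector $v=(v_1,\dots,v_q)\in Z_s^q$ is $A$-covering if for every $a \in A$ there is $1 \le i \le q$ with $v_i = a$. A family $\mathcal{F} \subseteq Z_s^q$ is $A$-covering if for every ordered pair of distinct vectors $u,v \in \mathcal{F}$ the difference $u-v$ is $A$-covering; it is covering if it is $Z_s$-covering. $R(s,q)$ denotes the maximum possible cardinality of a covering family in $Z_s^q$.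
   Formalization: In (2), δ is restricted to rational 0 < δ ≤ 2: for δ ≥ 4 and even q the literal inequality fails, as (2-δ)^q ≥ 2^q > 2^{q-1} ≥ R(s,q); real δ in (0,2], and 2 < δ < 4 via 4-δ, follow by monotonicity. -}

module Defs where

open import Data.Empty using (⊥-elim)
open import Data.Fin.Base using (Fin; zero; suc; toℕ; combine)
open import Data.Fin.Properties using (combine-injective; injective⇒≤; all?; any?; _≟_)
open import Data.Fin.Subset using (Subset; _∈_; ⊤)
open import Data.Fin.Subset.Properties using (_∈?_)
open import Data.List.Base as List using (List; []; length)
open import Data.List.Membership.Propositional using () renaming (_∈_ to _∈ₗ_)
open import Data.List.Membership.Propositional.Properties using (∈-lookup)
open import Data.List.Relation.Unary.All as All using (All)
open import Data.List.Relation.Unary.Unique.Propositional using (Unique; []; _∷_)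
open import Data.Nat.Base using (ℕ; zero; suc; _+_; _∸_; _^_; _≤_)
open import Data.Nat.DivMod using (_mod_)
open import Data.Nat.Properties using (m≤n⇒m<n∨m≡n; ≤-pred)
open import Data.Product.Base using (∃; _×_; _,_; proj₁)
open import Data.Sum.Base using (inj₁; inj₂)
open import Data.Vec.Base using (Vec; []; _∷_; lookup; zipWith; toList; fromList)
open import Data.Vec.Properties using (≡-dec; length-toList; toList∘fromList)
open import Level using (0ℓ)
open import Relation.Binary.PropositionalEquality
  using (_≡_; _≢_; refl; sym; cong; cong₂; subst)
open import Relation.Nullary using (Dec; yes; no)
open import Relation.Nullary.Decidable using (map′; _×-dec_; _→-dec_; ¬?)
open import Relation.Unary using (Pred; Decidable)

private variable
  s q : ℕ

-- Z_s is represented by the residues Fin s; _⊖_ is subtraction modulo s.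

infixl 6 _⊖_ _⊟_

_⊖_ : Fin s → Fin s → Fin s
_⊖_ {suc s} a b = (toℕ a + (suc s ∸ toℕ b)) mod suc s

_⊟_ : Vec (Fin s) q → Vec (Fin s) q → Vec (Fin s) q
_⊟_ = zipWith _⊖_

VectorCovering : Subset s → Pred (Vec (Fin s) q) 0ℓ
VectorCovering A v = ∀ a → a ∈ A → ∃ λ i → lookup v i ≡ a

FamilyCovering : Subset s → Pred (List (Vec (Fin s) q)) 0ℓ
FamilyCovering A F = ∀ {u v} → u ∈ₗ F → v ∈ₗ F → u ≢ v → VectorCovering A (u ⊟ v)

Covering : Pred (List (Vec (Fin s) q)) 0ℓ
Covering = FamilyCovering ⊤

-- A family of vectors is a finite set, represented by a duplicate-free list;
-- its cardinality is then the length of that list.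

Attained : (s q r : ℕ) → Set
Attained s q r = ∃ λ (F : List (Vec (Fin s) q)) → Unique F × Covering F × length F ≡ r

record IsMaximumSize (s q r : ℕ) : Set where
  field
    attained : Attained s q r
    maximal  : ∀ (F : List (Vec (Fin s) q)) → Unique F → Covering F → length F ≤ r

-- A maximum exists: sizes are bounded by s ^ q, and whether a given size is
-- attained is decided by exhaustive search.

private
  encode : Vec (Fin s) q → Fin (s ^ q)
  encode []       = zero
  encode (x ∷ xs) = combine x (encode xs)

  encode-injective : (u v : Vec (Fin s) q) → encode u ≡ encode v → u ≡ v
  encode-injective []       []       _  = refl
  encode-injective (x ∷ xs) (y ∷ ys) eq
    with x≡y , eq′ ← combine-injective x (encode xs) y (encode ys) eq
    = cong₂ _∷_ x≡y (encode-injective xs ys eq′)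

  lookup-injective : ∀ {X : Set} {xs : List X} → Unique xs → ∀ i j →
                     List.lookup xs i ≡ List.lookup xs j → i ≡ j
  lookup-injective (_  ∷ _)  zero    zero    _  = refl
  lookup-injective (x∉ ∷ _)  zero    (suc j) eq = ⊥-elim (All.lookup x∉ (∈-lookup j) eq)
  lookup-injective (x∉ ∷ _)  (suc i) zero    eq = ⊥-elim (All.lookup x∉ (∈-lookup i) (sym eq))
  lookup-injective (_  ∷ x!) (suc i) (suc j) eq = cong suc (lookup-injective x! i j eq)

  length≤ : (F : List (Vec (Fin s) q)) → Unique F → length F ≤ s ^ q
  length≤ F F! = injective⇒≤ {f = λ i → encode (List.lookup F i)}
    λ {i} {j} eq → lookup-injective F! i j (encode-injective _ _ eq)

  Searchable : Set → Set₁
  Searchable X = ∀ {P : Pred X 0ℓ} → Decidable P → Dec (∃ P)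

  searchVec : ∀ {X} → Searchable X → ∀ n → Searchable (Vec X n)
  searchVec S zero    P? = map′ ([] ,_) (λ { ([] , p) → p }) (P? [])
  searchVec S (suc n) P? =
    map′ (λ (x , xs , p) → x ∷ xs , p) (λ { (x ∷ xs , p) → x , xs , p })
      (S λ x → searchVec S n λ xs → P? (x ∷ xs))

  vectorCovering? : (A : Subset s) (v : Vec (Fin s) q) → Dec (VectorCovering A v)
  vectorCovering? A v = all? λ a → (a ∈? A) →-dec any? λ i → lookup v i ≟ a

  uniqueCovering? : (F : List (Vec (Fin s) q)) → Dec (Unique F × Covering F)
  uniqueCovering? F = unique? F ×-dec map′
    (λ c u∈ v∈ → All.lookup (All.lookup c u∈) v∈)
    (λ c → All.tabulate λ u∈ → All.tabulate λ v∈ → c u∈ v∈)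
    (All.all? (λ u → All.all? (λ v → ¬? (u ≟ᵥ v) →-dec vectorCovering? ⊤ (u ⊟ v)) F) F)
    where
    _≟ᵥ_ = ≡-dec _≟_
    open import Data.List.Relation.Unary.Unique.DecPropositional _≟ᵥ_ using (unique?)

  attained? : ∀ s q r → Dec (Attained s q r)
  attained? s q r = map′
    (λ (V , V! , c) → toList V , V! , c , length-toList V)
    (λ { (F , F! , c , refl) → fromList F ,
      subst (λ G → Unique G × Covering G) (sym (toList∘fromList F)) (F! , c) })
    (searchVec (searchVec any? q) r λ V → uniqueCovering? (toList V))

  maximum : ∀ {P : Pred ℕ 0ℓ} → Decidable P → P 0 → ∀ n →
            ∃ λ r → P r × (∀ m → m ≤ n → P m → m ≤ r)
  maximum P? p₀ zero    = 0 , p₀ , λ m m≤0 _ → m≤0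
  maximum P? p₀ (suc n) with P? (suc n)
  ... | yes p = suc n , p , λ m m≤ _ → m≤
  ... | no ¬p with r , p , max ← maximum P? p₀ n = r , p , below
    where
    below : ∀ m → m ≤ suc n → _ → m ≤ r
    below m m≤ pm with m≤n⇒m<n∨m≡n m≤
    ... | inj₁ m<    = max m (≤-pred m<) pm
    ... | inj₂ refl  = ⊥-elim (¬p pm)

abstract
  maximumSize : ∀ s q → ∃ (IsMaximumSize s q)
  maximumSize s q
    with r , att , max ← maximum (attained? s q) ([] , [] , (λ ()) , refl) (s ^ q)
    = r , record
    { attained = att
    ; maximal  = λ F F! c → max (length F) (length≤ F F!) (F , F! , c , refl)
    }

R : ℕ → ℕ → ℕ
R s q = proj₁ (maximumSize s q)

{-# OPTIONS --safe #-}

-- Upper bound. For u, v in a covering family, the polynomial ∏ᵢ (uᵢ − (vᵢ + 1)),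
-- with residues read as integers and v + 1 reduced modulo s, vanishes as soon as
-- 1 is a coordinate of u − v and never vanishes for u = v. It is a sum of 2^q products
-- of a function of u and a function of v, and the matrix of its values on F + (1,…,1)
-- followed by F is triangular, so 2 |F| ≤ 2^q.
--
-- Lower bound. For a single a, take words over 2 s letters: residues x decorated
-- with one of the two edges of the digraph x → x + a through x. Two distinct words
-- with the same edges and the same number of heads among them differ by exactly a
-- somewhere, so s^n (n + 1) colours suffice for (2 s)^n words. Colourings for a set
-- A and for a residue a are merged by regarding a word as an edge from its first to
-- its second colour and recording how far a sequence of N such edges is from a
-- path: the first and the last block where two sequences differ take care of A and
-- a, at the cost of N + 1 instead of N colours. A largest colour class is a
-- covering family of size about 2^n.
module Submission where

open import Defs
open import Data.Integer.Base using (+_)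
open import Data.Nat.Base using (ℕ; _∸_; _^_; _≤_)
open import Data.Product.Base using (_×_; ∃)
open import Data.Rational.Base using (ℚ; 0ℚ; _/_; _-_; +-*-rawSemiring) renaming (_≤_ to _≤ℚ_; _<_ to _<ℚ_)
open import Algebra.Definitions.RawSemiring +-*-rawSemiring using () renaming (_^_ to _^ℚ_)
open import Relation.Binary.PropositionalEquality using (_≡_)

open import Data.Bool.Base using (Bool; true; false)
import Data.Bool.Properties as Bool
open import Data.Empty using (⊥-elim)
open import Data.Fin.Base as Fin
  using (Fin; zero; suc; toℕ; fromℕ<; combine; funToFin; finToFun; inject≤)
open import Data.Fin.Properties as Fin
  using (toℕ-fromℕ<; toℕ-injective; toℕ<n; toℕ≤n; finToFun-funToFin; combine-injective;
         fromℕ<-injective; inject≤-injective)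
open import Data.Fin.Subset.Properties using (∈⊤)
open import Data.Integer.Base as ℤ using (ℤ; 0ℤ; 1ℤ; -[1+_])
import Data.Integer.Properties as ℤ
open import Data.Integer.Tactic.RingSolver renaming (solve-∀ to solveℤ-∀)
open import Data.List.Base as List using (List; []; _∷_; length; allFin)
open import Data.List.Membership.Propositional using () renaming (_∈_ to _∈ₗ_)
open import Data.List.Membership.Propositional.Properties using (∈-map⁻; ∈-allFin)
open import Data.List.Properties using (length-map; length-++; length-tabulate)
open import Data.List.Relation.Unary.All as All using (All; []; _∷_)
import Data.List.Relation.Unary.All.Properties as All
open import Data.List.Relation.Unary.AllPairs as AllPairs using (AllPairs; []; _∷_)
import Data.List.Relation.Unary.AllPairs.Properties as AllPairs
open import Data.List.Relation.Unary.Any using (here; there)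
open import Data.List.Relation.Unary.Unique.Propositional using (Unique)
import Data.List.Relation.Unary.Unique.Propositional.Properties as Unique
open import Data.Nat.Base
  using (zero; suc; _+_; _*_; _⊔_; _<_; _≥_; z≤n; s≤s; NonZero; >-nonZero)
open import Data.Nat.DivMod
  using (_mod_; _%_; m<n⇒m%n≡m; %-distribˡ-+; m%n%n≡m%n; [m+n]%n≡m%n; m≡m%n+[m/n]*n; m%n<n)
  renaming (_/_ to _÷_)
open import Data.Nat.Properties
open import Data.Nat.Tactic.RingSolver using (solve-∀)
open import Data.Product.Base using (_,_; proj₁; proj₂)
import Data.Product.Properties as Product
import Data.Rational.Base as ℚ
import Data.Rational.Properties as ℚ
import Data.Rational.Unnormalised.Base as ℚᵘ
import Data.Rational.Unnormalised.Properties as ℚᵘ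
open import Data.Sum.Base using (_⊎_; inj₁; inj₂)
open import Data.Vec.Base as Vec
  using (Vec; []; _∷_; _++_; lookup; removeAt; zipWith; concat; group; tabulate)
open import Data.Vec.Properties
  using (lookup-map; lookup-zipWith; lookup-concat; ≡-dec; tabulate∘lookup; tabulate-cong;
         ∷-injective; ∷-injectiveʳ)
open import Function.Base using (_∘_; _on_; id)
open import Level using (0ℓ)
open import Relation.Binary.Core using (Rel)
open import Relation.Binary.Definitions using (DecidableEquality)
open import Relation.Binary.PropositionalEquality
  using (_≢_; refl; sym; trans; cong; cong₂; subst; subst₂; module ≡-Reasoning)
open import Relation.Nullary using (yes; no)
open import Relation.Nullary.Decidable using (¬?)
open import Relation.Unary using (Pred; Decidable)

private variable
  s q n K : ℕ
  T : Set
  G : Rel T 0ℓ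

-- Addition and subtraction modulo s.

infixl 6 _⊕_

_⊕_ : Fin s → Fin s → Fin s
_⊕_ {suc s} a b = (toℕ a + toℕ b) mod suc s

⊕-comm : (a b : Fin s) → a ⊕ b ≡ b ⊕ a
⊕-comm {suc s} a b = cong (_mod suc s) (+-comm (toℕ a) (toℕ b))

toℕ-mod : ∀ m → toℕ (m mod suc s) ≡ m % suc s
toℕ-mod m = toℕ-fromℕ< _

-- Shared core of `⊖⇒⊕` and `⊕⇒⊖`: subtraction adds a complement to the modulus, so undoing it
-- returns to the residue plus one full modulus.
absorb : ∀ m k (a : Fin (suc s)) → m + k ≡ toℕ a + suc s → (m + k % suc s) % suc s ≡ toℕ a
absorb {s} m k a eq = begin
  (m + k % suc s) % suc s                    ≡⟨ %-distribˡ-+ m (k % suc s) (suc s) ⟩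
  (m % suc s + k % suc s % suc s) % suc s    ≡⟨ cong (λ z → (m % suc s + z) % suc s) (m%n%n≡m%n k (suc s)) ⟩
  (m % suc s + k % suc s) % suc s            ≡⟨ %-distribˡ-+ m k (suc s) ⟨
  (m + k) % suc s                            ≡⟨ cong (_% suc s) eq ⟩
  (toℕ a + suc s) % suc s                    ≡⟨ [m+n]%n≡m%n (toℕ a) (suc s) ⟩
  toℕ a % suc s                              ≡⟨ m<n⇒m%n≡m (toℕ<n a) ⟩
  toℕ a                                      ∎
  where open ≡-Reasoning

⊖⇒⊕ : ∀ (a b : Fin s) {c} → a ⊖ b ≡ c → a ≡ b ⊕ c
⊖⇒⊕ {suc s} a b refl = toℕ-injective (begin
  toℕ a                                              ≡⟨ absorb (toℕ b) k a eq ⟨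
  (toℕ b + k % suc s) % suc s                        ≡⟨ cong (λ z → (toℕ b + z) % suc s) (toℕ-mod k) ⟨
  (toℕ b + toℕ (k mod suc s)) % suc s                ≡⟨ toℕ-mod (toℕ b + toℕ (a ⊖ b)) ⟨
  toℕ (b ⊕ (a ⊖ b))                                  ∎)
  where
  open ≡-Reasoning
  k = toℕ a + (suc s ∸ toℕ b)
  eq : toℕ b + k ≡ toℕ a + suc s
  eq = begin
    toℕ b + (toℕ a + (suc s ∸ toℕ b))   ≡⟨ +-comm (toℕ b) _ ⟩
    toℕ a + (suc s ∸ toℕ b) + toℕ b     ≡⟨ +-assoc (toℕ a) _ _ ⟩
    toℕ a + (suc s ∸ toℕ b + toℕ b)     ≡⟨ cong (λ z → toℕ a + z) (m∸n+n≡m (toℕ≤n b)) ⟩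
    toℕ a + suc s                       ∎

⊕⇒⊖ : ∀ {a} (b c : Fin s) → a ≡ b ⊕ c → a ⊖ b ≡ c
⊕⇒⊖ {suc s} b c refl = toℕ-injective (begin
  toℕ ((b ⊕ c) ⊖ b)                           ≡⟨ toℕ-mod (toℕ (b ⊕ c) + (suc s ∸ toℕ b)) ⟩
  (toℕ (b ⊕ c) + (suc s ∸ toℕ b)) % suc s     ≡⟨ cong (_% suc s) (+-comm (toℕ (b ⊕ c)) _) ⟩
  (suc s ∸ toℕ b + toℕ (b ⊕ c)) % suc s       ≡⟨ cong (λ z → (suc s ∸ toℕ b + z) % suc s) (toℕ-mod k) ⟩
  (suc s ∸ toℕ b + k % suc s) % suc s         ≡⟨ absorb (suc s ∸ toℕ b) k c eq ⟩
  toℕ c                                       ∎)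
  where
  open ≡-Reasoning
  k = toℕ b + toℕ c
  eq : suc s ∸ toℕ b + k ≡ toℕ c + suc s
  eq = begin
    suc s ∸ toℕ b + (toℕ b + toℕ c)  ≡⟨ +-assoc (suc s ∸ toℕ b) _ _ ⟨
    suc s ∸ toℕ b + toℕ b + toℕ c    ≡⟨ cong (_+ toℕ c) (m∸n+n≡m (toℕ≤n b)) ⟩
    suc s + toℕ c                    ≡⟨ +-comm (suc s) _ ⟩
    toℕ c + suc s                    ∎

⊖-swap : ∀ (a b : Fin s) {c} → a ⊖ b ≡ c → a ⊖ c ≡ b
⊖-swap a b {c} eq = ⊕⇒⊖ c b (trans (⊖⇒⊕ a b eq) (⊕-comm b c))

⊖-cancelˡ : (a b c : Fin s) → a ⊖ b ≡ a ⊖ c → b ≡ c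
⊖-cancelˡ a b c eq = trans (sym (⊖-swap a b refl)) (⊖-swap a c (sym eq))

⊖-cancelʳ : (a b c : Fin s) → a ⊖ c ≡ b ⊖ c → a ≡ b
⊖-cancelʳ a b c eq = trans (⊖⇒⊕ a c eq) (sym (⊖⇒⊕ b c refl))

⊕-identityʳ : (a : Fin (suc s)) → a ⊕ zero ≡ a
⊕-identityʳ {s} a = toℕ-injective (begin
  toℕ (a ⊕ zero)       ≡⟨ toℕ-mod (toℕ a + 0) ⟩
  (toℕ a + 0) % suc s  ≡⟨ cong (_% suc s) (+-identityʳ (toℕ a)) ⟩
  toℕ a % suc s        ≡⟨ m<n⇒m%n≡m (toℕ<n a) ⟩
  toℕ a                ∎)
  where open ≡-Reasoning

⊖-self : (a : Fin (suc s)) → a ⊖ a ≡ zero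
⊖-self a = ⊕⇒⊖ a zero (sym (⊕-identityʳ a))

-- Skew orthogonal systems of integer vectors.

dot : Vec ℤ n → Vec ℤ n → ℤ
dot []       []       = 0ℤ
dot (x ∷ xs) (y ∷ ys) = x ℤ.* y ℤ.+ dot xs ys

dot-combine : ∀ c d (a a′ b : Vec ℤ n) →
  dot (zipWith (λ x y → c ℤ.* x ℤ.- d ℤ.* y) a a′) b ≡ c ℤ.* dot a b ℤ.- d ℤ.* dot a′ b
dot-combine c d []      []        []      = lemma c d
  where
  lemma : ∀ c d → 0ℤ ≡ c ℤ.* 0ℤ ℤ.- d ℤ.* 0ℤ
  lemma = solveℤ-∀
dot-combine c d (x ∷ a) (y ∷ a′) (z ∷ b) rewrite dot-combine c d a a′ b =
  lemma c d x y z (dot a b) (dot a′ b)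
  where
  lemma : ∀ c d x y z p p′ → (c ℤ.* x ℤ.- d ℤ.* y) ℤ.* z ℤ.+ (c ℤ.* p ℤ.- d ℤ.* p′)
                           ≡ c ℤ.* (x ℤ.* z ℤ.+ p) ℤ.- d ℤ.* (y ℤ.* z ℤ.+ p′)
  lemma = solveℤ-∀

dot-removeAt : (a b : Vec ℤ (suc n)) (p : Fin (suc n)) →
  dot a b ≡ lookup a p ℤ.* lookup b p ℤ.+ dot (removeAt a p) (removeAt b p)
dot-removeAt (x ∷ a)         (y ∷ b)         zero    = refl
dot-removeAt (x ∷ a@(_ ∷ _)) (y ∷ b@(_ ∷ _)) (suc p)
  rewrite dot-removeAt a b p
  = lemma (x ℤ.* y) (lookup a p ℤ.* lookup b p) (dot (removeAt a p) (removeAt b p))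
  where
  lemma : ∀ u v w → u ℤ.+ (v ℤ.+ w) ≡ v ℤ.+ (u ℤ.+ w)
  lemma = solveℤ-∀

dot≢0⇒nonzero : (a b : Vec ℤ n) → dot a b ≢ 0ℤ → ∃ λ p → lookup a p ≢ 0ℤ
dot≢0⇒nonzero []      []      ≢0 = ⊥-elim (≢0 refl)
dot≢0⇒nonzero (x ∷ a) (y ∷ b) ≢0 with x ℤ.≟ 0ℤ
... | no x≢0 = zero , x≢0
... | yes refl with p , ap≢0 ← dot≢0⇒nonzero a b (λ eq → ≢0 (trans (ℤ.+-identityˡ _) eq))
  = suc p , ap≢0

-- During elimination, orthogonality of the first left vector to each later right vector must stay
-- available beside the pairwise relation.
AllPairs-strengthenʳ : ∀ {a p r} {A : Set a} {P : Pred A p} {R : Rel A r} {xs : List A} →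
  All P xs → AllPairs R xs → AllPairs (λ x y → P y × R x y) xs
AllPairs-strengthenʳ []       []       = []
AllPairs-strengthenʳ (_ ∷ ps) (r ∷ rs) = All.zip (ps , r) ∷ AllPairs-strengthenʳ ps rs

-- Eliminating a coordinate where the first left vector is nonzero leaves a
-- skew system with one pair less in one dimension less.
skew-length≤ : ∀ n (xs : List (Vec ℤ n × Vec ℤ n)) →
  All (λ (a , b) → dot a b ≢ 0ℤ) xs →
  AllPairs (λ (a , _) (_ , b) → dot a b ≡ 0ℤ) xs →
  length xs ≤ n
skew-length≤ n       []                 _           _         = z≤n
skew-length≤ zero    (([] , []) ∷ xs)   (≢0 ∷ _)    _         = ⊥-elim (≢0 refl)
skew-length≤ (suc n) ((a₁ , b₁) ∷ xs)   (≢0 ∷ ≢0s)  (≡0 ∷ ≡0s)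
  with p , c≢0 ← dot≢0⇒nonzero a₁ b₁ ≢0
  = s≤s (subst (_≤ n) (length-map f xs) (skew-length≤ n (List.map f xs)
      (All.map⁺ (All.map (λ {x} → diagonal {x}) (All.zip (≡0 , ≢0s))))
      (AllPairs.map⁺ (AllPairs.map (λ {x y} → offDiagonal {x} {y})
        (AllPairs-strengthenʳ {R = λ (a , _) (_ , b) → dot a b ≡ 0ℤ} ≡0 ≡0s)))))
  where
  c = lookup a₁ p
  -- Multiplying by the pivot `c` instead of dividing by it keeps entries integral, and a nonzero
  -- factor cannot make a nonzero integer vanish.
  elim : Vec ℤ (suc n) → Vec ℤ (suc n)
  elim a = zipWith (λ x y → c ℤ.* x ℤ.- lookup a p ℤ.* y) a a₁
  f : Vec ℤ (suc n) × Vec ℤ (suc n) → Vec ℤ n × Vec ℤ n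
  f (a , b) = removeAt (elim a) p , removeAt b p

  -- Entry `p` of `elim a` cancels, so deleting it loses nothing; the `a₁` part drops out because
  -- `a₁` is orthogonal to `b`.
  dot-f : ∀ a b → dot a₁ b ≡ 0ℤ → dot (removeAt (elim a) p) (removeAt b p) ≡ c ℤ.* dot a b
  dot-f a b a₁b≡0 = begin
    dot (removeAt (elim a) p) (removeAt b p)
      ≡⟨ lemma₁ c (lookup a p) (lookup b p) _ ⟩
    (c ℤ.* lookup a p ℤ.- lookup a p ℤ.* c) ℤ.* lookup b p ℤ.+ dot (removeAt (elim a) p) (removeAt b p)
      ≡⟨ cong (λ z → z ℤ.* lookup b p ℤ.+ dot (removeAt (elim a) p) (removeAt b p))
              (lookup-zipWith _ p a a₁) ⟨
    lookup (elim a) p ℤ.* lookup b p ℤ.+ dot (removeAt (elim a) p) (removeAt b p)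
      ≡⟨ dot-removeAt (elim a) b p ⟨
    dot (elim a) b
      ≡⟨ dot-combine c (lookup a p) a a₁ b ⟩
    c ℤ.* dot a b ℤ.- lookup a p ℤ.* dot a₁ b
      ≡⟨ cong (λ z → c ℤ.* dot a b ℤ.- lookup a p ℤ.* z) a₁b≡0 ⟩
    c ℤ.* dot a b ℤ.- lookup a p ℤ.* 0ℤ
      ≡⟨ lemma₂ (c ℤ.* dot a b) (lookup a p) ⟩
    c ℤ.* dot a b ∎
    where
    open ≡-Reasoning
    lemma₁ : ∀ c x y z → z ≡ (c ℤ.* x ℤ.- x ℤ.* c) ℤ.* y ℤ.+ z
    lemma₁ = solveℤ-∀
    lemma₂ : ∀ u x → u ℤ.- x ℤ.* 0ℤ ≡ u
    lemma₂ = solveℤ-∀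

  diagonal : ∀ {(a , b) : Vec ℤ (suc n) × Vec ℤ (suc n)} → dot a₁ b ≡ 0ℤ × dot a b ≢ 0ℤ →
    dot (proj₁ (f (a , b))) (proj₂ (f (a , b))) ≢ 0ℤ
  diagonal {a , b} (a₁b≡0 , ab≢0) eq
    with ℤ.i*j≡0⇒i≡0∨j≡0 c (trans (sym (dot-f a b a₁b≡0)) eq)
  ... | inj₁ c≡0  = c≢0 c≡0
  ... | inj₂ ab≡0 = ab≢0 ab≡0

  offDiagonal : ∀ {(a , b) (a′ , b′) : Vec ℤ (suc n) × Vec ℤ (suc n)} →
    dot a₁ b′ ≡ 0ℤ × dot a b′ ≡ 0ℤ →
    dot (proj₁ (f (a , b))) (proj₂ (f (a′ , b′))) ≡ 0ℤ
  offDiagonal {a , _} {_ , b′} (a₁b′≡0 , ab′≡0) =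
    trans (dot-f a b′ a₁b′≡0) (trans (cong (c ℤ.*_) ab′≡0) (ℤ.*-zeroʳ c))

dot-++ : ∀ {m} (a b : Vec ℤ m) (a′ b′ : Vec ℤ n) → dot (a ++ a′) (b ++ b′) ≡ dot a b ℤ.+ dot a′ b′
dot-++ []      []      a′ b′ = sym (ℤ.+-identityˡ _)
dot-++ (x ∷ a) (y ∷ b) a′ b′ rewrite dot-++ a b a′ b′ = sym (ℤ.+-assoc (x ℤ.* y) _ _)

dot-scaleˡ : ∀ c (a b : Vec ℤ n) → dot (Vec.map (c ℤ.*_) a) b ≡ c ℤ.* dot a b
dot-scaleˡ c []      []      = sym (ℤ.*-zeroʳ c)
dot-scaleˡ c (x ∷ a) (y ∷ b) rewrite dot-scaleˡ c a b = lemma c x y (dot a b)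
  where
  lemma : ∀ c x y z → c ℤ.* x ℤ.* y ℤ.+ c ℤ.* z ≡ c ℤ.* (x ℤ.* y ℤ.+ z)
  lemma = solveℤ-∀

dot-scaleʳ : ∀ c (a b : Vec ℤ n) → dot a (Vec.map (c ℤ.*_) b) ≡ c ℤ.* dot a b
dot-scaleʳ c []      []      = sym (ℤ.*-zeroʳ c)
dot-scaleʳ c (x ∷ a) (y ∷ b) rewrite dot-scaleʳ c a b = lemma c x y (dot a b)
  where
  lemma : ∀ c x y z → x ℤ.* (c ℤ.* y) ℤ.+ c ℤ.* z ≡ c ℤ.* (x ℤ.* y ℤ.+ z)
  lemma = solveℤ-∀

-- The product of coordinate differences as a dot product in dimension 2^q.

∏[_-_] : Vec ℤ q → Vec ℤ q → ℤ
∏[ [] - [] ]         = 1ℤ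
∏[ x ∷ xs - y ∷ ys ] = (x ℤ.- y) ℤ.* ∏[ xs - ys ]

-- The terms of the expanded product: each coordinate contributes x on the left or -y on the right.
-- The trailing `[]` matches the unfolding of 2 ^ suc q to 2 ^ q + (2 ^ q + 0).
termsˡ termsʳ : Vec ℤ q → Vec ℤ (2 ^ q)
termsˡ []       = 1ℤ ∷ []
termsˡ (x ∷ xs) = Vec.map (x ℤ.*_) (termsˡ xs) ++ (termsˡ xs ++ [])
termsʳ []       = 1ℤ ∷ []
termsʳ (y ∷ ys) = termsʳ ys ++ (Vec.map (ℤ.- y ℤ.*_) (termsʳ ys) ++ [])

dot-terms : (xs ys : Vec ℤ q) → dot (termsˡ xs) (termsʳ ys) ≡ ∏[ xs - ys ]
dot-terms []       []       = refl
dot-terms (x ∷ xs) (y ∷ ys)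
  rewrite dot-++ (Vec.map (x ℤ.*_) (termsˡ xs)) (termsʳ ys) (termsˡ xs ++ [])
                 (Vec.map (ℤ.- y ℤ.*_) (termsʳ ys) ++ [])
        | dot-++ (termsˡ xs) (Vec.map (ℤ.- y ℤ.*_) (termsʳ ys)) [] []
        | dot-scaleˡ x (termsˡ xs) (termsʳ ys)
        | dot-scaleʳ (ℤ.- y) (termsˡ xs) (termsʳ ys)
        | dot-terms xs ys
  = lemma x y ∏[ xs - ys ]
  where
  lemma : ∀ x y z → x ℤ.* z ℤ.+ (ℤ.- y ℤ.* z ℤ.+ 0ℤ) ≡ (x ℤ.- y) ℤ.* z
  lemma = solveℤ-∀

∏≡0 : (xs ys : Vec ℤ q) → (∃ λ i → lookup xs i ≡ lookup ys i) → ∏[ xs - ys ] ≡ 0ℤ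
∏≡0 (x ∷ xs) (x ∷ ys) (zero  , refl) rewrite ℤ.i≡j⇒i-j≡0 {x} refl = refl
∏≡0 (x ∷ xs) (y ∷ ys) (suc i , eq) rewrite ∏≡0 xs ys (i , eq) = ℤ.*-zeroʳ (x ℤ.- y)

∏≢0 : (xs ys : Vec ℤ q) → (∀ i → lookup xs i ≢ lookup ys i) → ∏[ xs - ys ] ≢ 0ℤ
∏≢0 []       []       _  ()
∏≢0 (x ∷ xs) (y ∷ ys) ne eq with ℤ.i*j≡0⇒i≡0∨j≡0 (x ℤ.- y) eq
... | inj₁ x-y≡0 = ne zero (ℤ.i-j≡0⇒i≡j x y x-y≡0)
... | inj₂ ∏≡0   = ∏≢0 xs ys (ne ∘ suc) ∏≡0

∃-lookup-map : ∀ {a b} {A : Set a} {B : Set b} (f g : A → B) (u v : Vec A n) →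
  (∃ λ i → f (lookup u i) ≡ g (lookup v i)) → ∃ λ i → lookup (Vec.map f u) i ≡ lookup (Vec.map g v) i
∃-lookup-map f g u v (i , eq) = i , trans (lookup-map i f u) (trans eq (sym (lookup-map i g v)))

-- The upper bound for covering families.

-- The term vectors of u and v pair to the product of all uᵢ - σ(vᵢ). It is nonzero for u = v
-- because `σ` has no fixed point, and the given coordinate makes it vanish whenever u precedes v.
successor-length≤ : ∀ q (σ : Fin s → Fin s) → (∀ x → x ≢ σ x) → (L : List (Vec (Fin s) q)) →
  AllPairs (λ u v → ∃ λ i → lookup u i ≡ σ (lookup v i)) L → length L ≤ 2 ^ q
successor-length≤ {s} q σ σ-free L pairs = subst (_≤ 2 ^ q) (length-map f L)
  (skew-length≤ (2 ^ q) (List.map f L)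
    (All.map⁺ (All.tabulate λ {u} _ → diagonal u))
    (AllPairs.map⁺ (AllPairs.map (λ {u v} → offDiagonal {u} {v}) pairs)))
  where
  ι : Fin s → ℤ
  ι x = + toℕ x
  f : Vec (Fin s) q → Vec ℤ (2 ^ q) × Vec ℤ (2 ^ q)
  f u = termsˡ (Vec.map ι u) , termsʳ (Vec.map (ι ∘ σ) u)

  diagonal : ∀ u → dot (proj₁ (f u)) (proj₂ (f u)) ≢ 0ℤ
  diagonal u eq = ∏≢0 (Vec.map ι u) (Vec.map (ι ∘ σ) u)
    (λ i e → σ-free (lookup u i) (toℕ-injective (ℤ.+-injective
      (trans (sym (lookup-map i ι u)) (trans e (lookup-map i (ι ∘ σ) u))))))
    (trans (sym (dot-terms (Vec.map ι u) (Vec.map (ι ∘ σ) u))) eq)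

  offDiagonal : ∀ {u v} → (∃ λ i → lookup u i ≡ σ (lookup v i)) → dot (proj₁ (f u)) (proj₂ (f v)) ≡ 0ℤ
  offDiagonal {u} {v} (i , eq) = trans (dot-terms (Vec.map ι u) (Vec.map (ι ∘ σ) v))
    (∏≡0 (Vec.map ι u) (Vec.map (ι ∘ σ) v) (∃-lookup-map ι (ι ∘ σ) u v (i , cong ι eq)))

covering⇒ : {F : List (Vec (Fin s) q)} → Covering F → ∀ {u v} → u ∈ₗ F → v ∈ₗ F → u ≢ v →
  ∀ a → ∃ λ i → lookup u i ⊖ lookup v i ≡ a
covering⇒ cov {u} {v} u∈ v∈ u≢v a with i , eq ← cov u∈ v∈ u≢v a ∈⊤
  = i , trans (sym (lookup-zipWith _⊖_ i u v)) eq

allPairs-distinct : ∀ {A : Set} {R : Rel A 0ℓ} {xs : List A} → Unique xs →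
  (∀ {x y} → x ∈ₗ xs → y ∈ₗ xs → x ≢ y → R x y) → AllPairs R xs
allPairs-distinct []       r = []
allPairs-distinct (x∉ ∷ x!) r =
  All.tabulate (λ y∈ → r (here refl) (there y∈) (All.lookup x∉ y∈)) ∷
  allPairs-distinct x! (λ x∈ y∈ → r (there x∈) (there y∈))

covering-length≤ : ∀ (F : List (Vec (Fin (2 + s)) (suc q))) → Unique F → Covering F → length F ≤ 2 ^ q
covering-length≤ {s} {q} F F! cov = *-cancelˡ-≤ 2 (begin
  2 * length F                        ≡⟨ cong (λ z → length F + z) (+-identityʳ _) ⟩
  length F + length F                 ≡⟨ cong (_+ length F) (length-map shift F) ⟨
  length (List.map shift F) + length F ≡⟨ length-++ (List.map shift F) ⟨
  length (List.map shift F List.++ F) ≤⟨ successor-length≤ (suc q) σ σ-free _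
    (AllPairs.++⁺ (AllPairs.map⁺ (allPairs-distinct F! λ {u v} → within⁺ {u} {v}))
      (allPairs-distinct F! λ {u v} → within {u} {v})
      (All.map⁺ (All.tabulate λ {u} u∈ → All.tabulate λ {v} v∈ → across {u} {v} u∈ v∈))) ⟩
  2 ^ suc q                           ∎)
  where
  open ≤-Reasoning
  σ : Fin (2 + s) → Fin (2 + s)
  σ = _⊕ suc zero
  shift : Vec (Fin (2 + s)) (suc q) → Vec (Fin (2 + s)) (suc q)
  shift = Vec.map σ

  σ-free : ∀ x → x ≢ σ x
  σ-free x eq with () ← trans (sym (⊖-self x)) (⊕⇒⊖ x (suc zero) eq)

  within : ∀ {u v : Vec (Fin (2 + s)) (suc q)} → u ∈ₗ F → v ∈ₗ F → u ≢ v →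
    ∃ λ i → lookup u i ≡ σ (lookup v i)
  within {u} {v} u∈ v∈ u≢v with i , eq ← covering⇒ cov u∈ v∈ u≢v (suc zero)
    = i , ⊖⇒⊕ (lookup u i) (lookup v i) eq

  within⁺ : ∀ {u v} → u ∈ₗ F → v ∈ₗ F → u ≢ v → ∃ λ i → lookup (shift u) i ≡ σ (lookup (shift v) i)
  within⁺ {u} {v} u∈ v∈ u≢v with i , eq ← within {u} {v} u∈ v∈ u≢v =
    i , trans (lookup-map i σ u) (cong σ (trans eq (sym (lookup-map i σ v))))

  -- With the shifted copy in front, the condition becomes uᵢ = vᵢ: the difference 0 provides it for
  -- distinct vectors, and any coordinate does for equal ones, here the first.
  across : ∀ {u v} → u ∈ₗ F → v ∈ₗ F → ∃ λ i → lookup (shift u) i ≡ σ (lookup v i)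
  across {u} {v} u∈ v∈ with ≡-dec Fin._≟_ u v
  ... | yes refl = zero , lookup-map zero σ u
  ... | no u≢v with i , eq ← covering⇒ cov u∈ v∈ u≢v zero
    = i , trans (lookup-map i σ u) (cong σ
        (trans (⊖⇒⊕ (lookup u i) (lookup v i) eq) (⊕-identityʳ (lookup v i))))

R-attained : ∀ s q → Attained s q (R s q)
R-attained s q = IsMaximumSize.attained (proj₂ (maximumSize s q))

length≤R : (F : List (Vec (Fin s) q)) → Unique F → Covering F → length F ≤ R s q
length≤R {s} {q} = IsMaximumSize.maximal (proj₂ (maximumSize s q))

R-upper : ∀ s q → 2 ≤ s → s ≤ q → R s q ≤ 2 ^ (q ∸ 1)
R-upper (suc (suc s)) (suc q) _ _ with F , F! , cov , eq ← R-attained (2 + s) (suc q)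
  = subst (_≤ 2 ^ q) eq (covering-length≤ F F! cov)
R-upper (suc (suc s)) zero _ ()
R-upper (suc zero) _ (s≤s ()) _

-- Colourings, their powers and chains.

-- In graph terms, a proper colouring of the complement of `G`: the colour classes are cliques of
-- `G`.
record Colouring (G : Rel T 0ℓ) (K : ℕ) : Set where
  field
    colour    : T → Fin K
    separates : ∀ {t t′} → colour t ≡ colour t′ → t ≢ t′ → G t t′

open Colouring

weaken : ∀ {K′} → K ≤ K′ → Colouring G K → Colouring G K′
weaken K≤K′ c = record
  { colour    = λ t → inject≤ (colour c t) K≤K′
  ; separates = λ eq → separates c (inject≤-injective K≤K′ K≤K′ _ _ eq)
  }

encode : Vec (Fin K) n → Fin (K ^ n)
encode v = funToFin (lookup v)

encode-injective : (u v : Vec (Fin K) n) → encode u ≡ encode v → u ≡ v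
encode-injective u v eq = begin
  u                                  ≡⟨ tabulate∘lookup u ⟨
  tabulate (lookup u)                ≡⟨ tabulate-cong (finToFun-funToFin (lookup u)) ⟨
  tabulate (finToFun (encode u))     ≡⟨ cong (tabulate ∘ finToFun) eq ⟩
  tabulate (finToFun (encode v))     ≡⟨ tabulate-cong (finToFun-funToFin (lookup v)) ⟩
  tabulate (lookup v)                ≡⟨ tabulate∘lookup v ⟩
  v                                  ∎
  where open ≡-Reasoning

Somewhere : Rel T 0ℓ → Rel (Vec T n) 0ℓ
Somewhere G u v = ∃ λ i → G (lookup u i) (lookup v i)

there-somewhere : ∀ {x y} {u v : Vec T n} → Somewhere G u v → Somewhere G (x ∷ u) (y ∷ v)
there-somewhere (i , g) = suc i , g

module _ {T : Set} (_≟_ : DecidableEquality T) where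

  distinct⇒somewhere : (u v : Vec T n) → u ≢ v → Somewhere _≢_ u v
  distinct⇒somewhere []      []      ne = ⊥-elim (ne refl)
  distinct⇒somewhere (x ∷ u) (y ∷ v) ne with x ≟ y
  ... | no x≢y   = zero , x≢y
  ... | yes refl = there-somewhere {G = _≢_} (distinct⇒somewhere u v (ne ∘ cong (x ∷_)))

  -- Recording the colour of every entry suffices: at any position where the words differ, equal
  -- colours already force `G`.
  power : ∀ {G : Rel T 0ℓ} n → Colouring G K → Colouring (Somewhere {n = n} G) (K ^ n)
  power {G = G} n c = record
    { colour    = encode ∘ Vec.map (colour c)
    ; separates = sep
    }
    where
    sep : ∀ {u v} → encode (Vec.map (colour c) u) ≡ encode (Vec.map (colour c) v) → u ≢ v → Somewhere G u v
    sep {u} {v} eq u≢v with i , ne ← distinct⇒somewhere u v u≢v = i , separates c (begin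
      colour c (lookup u i)              ≡⟨ lookup-map i (colour c) u ⟨
      lookup (Vec.map (colour c) u) i    ≡⟨ cong (λ w → lookup w i)
                                              (encode-injective (Vec.map (colour c) u) (Vec.map (colour c) v) eq) ⟩
      lookup (Vec.map (colour c) v) i    ≡⟨ lookup-map i (colour c) v ⟩
      colour c (lookup v i)              ∎) ne
      where open ≡-Reasoning

  module _ {G₁ G₂ : Rel T 0ℓ} (c₁ : Colouring G₁ K) (c₂ : Colouring G₂ K) where

    -- At the first block where two words of equal chain differ the c₁-colours
    -- agree, and at the last such block the c₂-colours agree. One colour per
    -- block serves both purposes.
    chain : Fin K → Vec T n → Vec (Fin K) (suc n)
    chain p []      = p ∷ []
    chain p (x ∷ u) = colour c₁ x ⊖ p ∷ chain (colour c₂ x) u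

    -- For a shared tail the first entry determines the colour handed over by the preceding block;
    -- `chain-last` recovers the `c₂`-colour of that block this way.
    chain-injective : ∀ p p′ (u : Vec T n) → chain p u ≡ chain p′ u → p ≡ p′
    chain-injective p p′ []      refl = refl
    chain-injective p p′ (x ∷ u) eq   = ⊖-cancelˡ (colour c₁ x) p p′ (proj₁ (∷-injective eq))

    chain-first : ∀ p (u v : Vec T n) → chain p u ≡ chain p v → u ≢ v → Somewhere G₁ u v
    chain-first p []      []      eq ne = ⊥-elim (ne refl)
    chain-first p (x ∷ u) (y ∷ v) eq ne with x ≟ y
    ... | no x≢y   = zero , separates c₁ (⊖-cancelʳ _ _ p (proj₁ (∷-injective eq))) x≢y
    ... | yes refl = there-somewhere {G = G₁} (chain-first _ u v (∷-injectiveʳ eq) (ne ∘ cong (x ∷_)))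

    -- The recursion runs past differing blocks until the tails coincide, so the incoming colours of
    -- the two words may differ on the way; hence separate `p` and `p′`.
    chain-last : ∀ p p′ (u v : Vec T n) → chain p u ≡ chain p′ v → u ≢ v → Somewhere G₂ u v
    chain-last p p′ []      []      eq ne = ⊥-elim (ne refl)
    chain-last p p′ (x ∷ u) (y ∷ v) eq ne with ≡-dec _≟_ u v
    ... | no u≢v   = there-somewhere {G = G₂} (chain-last _ _ u v (∷-injectiveʳ eq) u≢v)
    ... | yes refl = zero , separates c₂ (chain-injective _ _ u (∷-injectiveʳ eq)) (ne ∘ cong (_∷ u))

    chainColouring : Fin K → ∀ n →
      Colouring (λ (u v : Vec T n) → Somewhere G₁ u v × Somewhere G₂ u v) (K ^ suc n)
    chainColouring p n = record
      { colour    = encode ∘ chain p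
      ; separates = λ {u} {v} eq ne → let eq′ = encode-injective (chain p u) (chain p v) eq in
          chain-first p u v eq′ ne , chain-last p p u v eq′ ne
      }

-- Cutting into blocks is injective, so a colouring of sequences of blocks also colours plain words.
flatten : ∀ {X : Set} {m} {H : Rel (Vec (Vec X m) n) 0ℓ} {G : Rel (Vec X (n * m)) 0ℓ} →
  (∀ {u v} → H u v → G (concat u) (concat v)) → Colouring H K → Colouring G K
flatten {n = n} {m = m} {G = G} H⇒G c = record
  { colour    = λ t → colour c (proj₁ (group n m t))
  ; separates = λ {t} {t′} → sep {t} {t′}
  }
  where
  sep : ∀ {t t′} → colour c (proj₁ (group n m t)) ≡ colour c (proj₁ (group n m t′)) → t ≢ t′ → G t t′
  sep {t} {t′} eq ne with u , refl ← group n m t | v , refl ← group n m t′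
    = H⇒G (separates c eq (ne ∘ cong concat))

somewhere-concat : ∀ {m} {u v : Vec (Vec T m) n} → Somewhere (Somewhere G) u v →
  Somewhere G (concat u) (concat v)
somewhere-concat {G = G} {u = u} {v} (i , j , g) =
  combine i j , subst₂ G (sym (lookup-concat u i j)) (sym (lookup-concat v i j)) g

-- Words of decorated residues and their colourings.

-- A letter (x , b) stands for x together with the choice of an edge through x
-- in the digraph x → x + a: the one entering x if b holds, otherwise the one
-- leaving x. This makes the 2 s letters split into s pairs for every a at once.
Letter : ℕ → Set
Letter s = Fin s × Bool

_≟ₗ_ : DecidableEquality (Letter s)
_≟ₗ_ = Product.≡-dec Fin._≟_ Bool._≟_

Word : ℕ → ℕ → Set
Word s n = Vec (Letter s) n

Differ : Fin s → Rel (Word s n) 0ℓ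
Differ a = Somewhere (λ (x , _) (y , _) → x ⊖ y ≡ a)

DifferAll : List (Fin s) → Rel (Word s n) 0ℓ
DifferAll as u v = All (λ a → Differ a u v) as

-- The edge is named by its tail.
edge : Fin s → Letter s → Fin s
edge a (x , false) = x
edge a (x , true)  = x ⊖ a

weight : Word s n → ℕ
weight []              = 0
weight ((_ , false) ∷ t) = weight t
weight ((_ , true)  ∷ t) = suc (weight t)

weight≤ : (t : Word s n) → weight t ≤ n
weight≤ []                = z≤n
weight≤ ((_ , false) ∷ t) = m≤n⇒m≤1+n (weight≤ t)
weight≤ ((_ , true)  ∷ t) = s≤s (weight≤ t)

-- On a common edge, head against tail gives the difference `a`. If this never happens, every change
-- goes from a tail in `t` to a head in `t′`, which can only raise the weight. Equal weights then
-- leave no change at all.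
same-edges : ∀ (a : Fin s) (t t′ : Word s n) → Vec.map (edge a) t ≡ Vec.map (edge a) t′ →
  Differ a t t′ ⊎ t ≡ t′ ⊎ weight t < weight t′
same-edges a [] [] _ = inj₂ (inj₁ refl)
same-edges a ((x , b) ∷ t) ((x′ , b′) ∷ t′) eq
  with same-edges a t t′ (∷-injectiveʳ eq)
... | inj₁ (i , d) = inj₁ (suc i , d)
same-edges a ((x , true)  ∷ t) ((x′ , false) ∷ t′) eq | inj₂ _ =
  inj₁ (zero , ⊖-swap x a (proj₁ (∷-injective eq)))
same-edges a ((x , false) ∷ t) ((x′ , true)  ∷ t′) eq | inj₂ (inj₁ refl) = inj₂ (inj₂ (n<1+n _))
same-edges a ((x , false) ∷ t) ((x′ , true)  ∷ t′) eq | inj₂ (inj₂ w<w′) = inj₂ (inj₂ (m<n⇒m<1+n w<w′))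
same-edges a ((x , false) ∷ t) ((x′ , false) ∷ t′) eq | inj₂ (inj₁ refl)
  with refl ← proj₁ (∷-injective eq) = inj₂ (inj₁ refl)
same-edges a ((x , false) ∷ t) ((x′ , false) ∷ t′) eq | inj₂ (inj₂ w<w′) = inj₂ (inj₂ w<w′)
same-edges a ((x , true)  ∷ t) ((x′ , true)  ∷ t′) eq | inj₂ (inj₁ refl)
  with refl ← ⊖-cancelʳ x x′ a (proj₁ (∷-injective eq)) = inj₂ (inj₁ refl)
same-edges a ((x , true)  ∷ t) ((x′ , true)  ∷ t′) eq | inj₂ (inj₂ w<w′) = inj₂ (inj₂ (s≤s w<w′))

edgeColouring : ∀ (a : Fin s) n → Colouring (Differ {n = n} a) (s ^ n * suc n)
edgeColouring {s} a n = record
  { colour    = λ t → combine (encode (Vec.map (edge a) t)) (fromℕ< (s≤s (weight≤ t)))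
  ; separates = λ {t} {t′} → sep {t} {t′}
  }
  where
  sep : ∀ {t t′} → combine (encode (Vec.map (edge a) t)) (fromℕ< (s≤s (weight≤ t)))
                 ≡ combine (encode (Vec.map (edge a) t′)) (fromℕ< (s≤s (weight≤ t′))) → t ≢ t′ → Differ a t t′
  sep {t} {t′} eq t≢t′
    with eq₁ , eq₂ ← combine-injective (encode (Vec.map (edge a) t)) (fromℕ< (s≤s (weight≤ t))) _ _ eq
    with same-edges a t t′ (encode-injective _ _ eq₁)
  ... | inj₁ d           = d
  ... | inj₂ (inj₁ t≡t′) = ⊥-elim (t≢t′ t≡t′)
  ... | inj₂ (inj₂ w<w′) = ⊥-elim (<⇒≢ w<w′ (fromℕ<-injective _ _ (s≤s (weight≤ t)) (s≤s (weight≤ t′)) eq₂))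

differ-concat : ∀ {m} (a : Fin s) {u v : Vec (Word s m) n} →
  Somewhere (Differ a) u v → Differ a (concat u) (concat v)
differ-concat a {u} {v} = somewhere-concat {G = λ (x , _) (y , _) → x ⊖ y ≡ a} {u = u} {v}

powerWords : ∀ {as : List (Fin s)} k → Colouring (DifferAll {n = n} as) K →
  Colouring (DifferAll {n = k * n} as) (K ^ k)
powerWords k c = flatten
  (λ {u} {v} (i , ds) → All.map (λ {a} (j , d) → differ-concat a {u} {v} (i , j , d)) ds)
  (power (≡-dec _≟ₗ_) k c)

chainWords : ∀ {a} {as : List (Fin (suc s))} k →
  Colouring (DifferAll {n = n} as) K → Colouring (Differ {n = n} a) K →
  Colouring (DifferAll {n = k * n} (a ∷ as)) (K ^ suc k)
chainWords {n = n} {a = a} k c c′ = flatten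
  (λ {u} {v} ((i , ds) , d) → differ-concat a {u} {v} d ∷
    All.map (λ {b} (j , d′) → differ-concat b {u} {v} (i , j , d′)) ds)
  -- Any starting colour will do; the colour of a constant word is one that certainly exists.
  (chainColouring (≡-dec _≟ₗ_) c c′ (colour c (Vec.replicate n (zero , false))) k)

-- Counting words and extracting a large colour class.

length-split : ∀ {A : Set} {P : Pred A 0ℓ} (P? : Decidable P) xs →
  length xs ≡ length (List.filter P? xs) + length (List.filter (¬? ∘ P?) xs)
length-split P? []       = refl
length-split P? (x ∷ xs) with P? x
... | yes _ = cong suc (length-split P? xs)
... | no _  = trans (cong suc (length-split P? xs)) (sym (+-suc _ _))

-- Induction on the number of colours: the class of the top colour competes with the best class
-- among the remaining elements. Colours are natural numbers, so removing the top one changes no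
-- type.
pigeonhole : ∀ {A : Set} K (c : A → ℕ) (xs : List A) → Unique xs → All (λ x → c x < K) xs →
  ∃ λ ys → Unique ys × (∀ {x y} → x ∈ₗ ys → y ∈ₗ ys → c x ≡ c y) × length xs ≤ K * length ys
pigeonhole zero    c []       _   _       = [] , [] , (λ ()) , z≤n
pigeonhole zero    c (_ ∷ _)  _   (() ∷ _)
pigeonhole (suc K) c xs xs! c<
  with ys , ys! , mono , len ← pigeonhole K c (List.filter (λ x → ¬? (c x ≟ K)) xs)
    (Unique.filter⁺ _ xs!)
    (All.map (λ (≤K , ≢K) → ≤∧≢⇒< (≤-pred ≤K) ≢K)
      (All.zip (All.filter⁺ (λ x → ¬? (c x ≟ K)) c< , All.all-filter (λ x → ¬? (c x ≟ K)) xs)))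
  with ≤-total (length (List.filter (λ x → c x ≟ K) xs)) (length ys)
... | inj₁ zs≤ys = ys , ys! , mono , (begin
  length xs                                 ≡⟨ length-split (λ x → c x ≟ K) xs ⟩
  length zs + _                             ≤⟨ +-mono-≤ zs≤ys len ⟩
  length ys + K * length ys                 ∎)
  where
  open ≤-Reasoning
  zs = List.filter (λ x → c x ≟ K) xs
... | inj₂ ys≤zs = zs , Unique.filter⁺ _ xs! , mono-K , (begin
  length xs                                 ≡⟨ length-split (λ x → c x ≟ K) xs ⟩
  length zs + _                             ≤⟨ +-monoʳ-≤ (length zs) (≤-trans len (*-monoʳ-≤ K ys≤zs)) ⟩
  length zs + K * length zs                 ∎)
  where
  open ≤-Reasoning
  zs = List.filter (λ x → c x ≟ K) xs
  mono-K : ∀ {x y} → x ∈ₗ zs → y ∈ₗ zs → c x ≡ c y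
  mono-K x∈ y∈ = trans (All.lookup all-K x∈) (sym (All.lookup all-K y∈))
    where all-K = All.all-filter (λ x → c x ≟ K) xs

length-cartesianProductWith : ∀ {A B C : Set} (f : A → B → C) xs ys →
  length (List.cartesianProductWith f xs ys) ≡ length xs * length ys
length-cartesianProductWith f []       ys = refl
length-cartesianProductWith f (x ∷ xs) ys = trans (length-++ (List.map (f x) ys))
  (cong₂ _+_ (length-map (f x) ys) (length-cartesianProductWith f xs ys))

vectors : {A : Set} → List A → ∀ n → List (Vec A n)
vectors xs zero    = [] ∷ []
vectors xs (suc n) = List.cartesianProductWith _∷_ xs (vectors xs n)

vectors-unique : {A : Set} {xs : List A} → Unique xs → ∀ n → Unique (vectors xs n)
vectors-unique xs! zero    = [] ∷ []
vectors-unique xs! (suc n) = Unique.cartesianProductWith⁺ _∷_ ∷-injective xs! (vectors-unique xs! n)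

length-vectors : {A : Set} (xs : List A) → ∀ n → length (vectors xs n) ≡ length xs ^ n
length-vectors xs zero    = refl
length-vectors xs (suc n) = trans (length-cartesianProductWith _∷_ xs (vectors xs n))
  (cong (length xs *_) (length-vectors xs n))

letters : ∀ s → List (Letter s)
letters s = List.cartesianProductWith _,_ (allFin s) (false ∷ true ∷ [])

letters-unique : ∀ s → Unique (letters s)
letters-unique s = Unique.cartesianProductWith⁺ _,_ Product.,-injective
  (Unique.allFin⁺ s) (((λ ()) ∷ []) ∷ [] ∷ [])

length-letters : ∀ s → length (letters s) ≡ s * 2
length-letters s = trans (length-cartesianProductWith _,_ (allFin s) (false ∷ true ∷ []))
  (cong (_* 2) (length-tabulate {n = s} id))

-- A largest colour class has at least a 1/K share of all words. Dropping the decorations merges no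
-- two of them, since their residues differ by 1 somewhere and 1 is not 0 here.
colouring⇒R : Colouring (DifferAll {n = n} (allFin (2 + s))) K → ((2 + s) * 2) ^ n ≤ K * R (2 + s) n
colouring⇒R {n} {s} {K} c
  with ys , ys! , mono , len ← pigeonhole K (toℕ ∘ colour c) (vectors (letters (2 + s)) n)
    (vectors-unique (letters-unique (2 + s)) n) (All.tabulate λ {t} _ → Fin.toℕ<n (colour c t))
  = begin
  ((2 + s) * 2) ^ n                       ≡⟨ cong (_^ n) (length-letters (2 + s)) ⟨
  length (letters (2 + s)) ^ n            ≡⟨ length-vectors (letters (2 + s)) n ⟨
  length (vectors (letters (2 + s)) n)    ≤⟨ len ⟩
  K * length ys                           ≡⟨ cong (K *_) (length-map base ys) ⟨
  K * length (List.map base ys)           ≤⟨ *-monoʳ-≤ K (length≤R (List.map base ys)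
      (AllPairs.map⁺ (allPairs-distinct ys! (λ {u} {v} → base-distinct {u} {v})))
      (λ {u} {v} → covering {u} {v})) ⟩
  K * R (2 + s) n                         ∎
  where
  open ≤-Reasoning
  base : Word (2 + s) n → Vec (Fin (2 + s)) n
  base = Vec.map proj₁

  differ : ∀ {u v} → u ∈ₗ ys → v ∈ₗ ys → u ≢ v → ∀ a → ∃ λ i → lookup (base u ⊟ base v) i ≡ a
  differ {u} {v} u∈ v∈ u≢v a
    with i , eq ← All.lookup (separates c (Fin.toℕ-injective (mono u∈ v∈)) u≢v) (∈-allFin a)
    = i , trans (lookup-zipWith _⊖_ i (base u) (base v))
        (trans (cong₂ _⊖_ (lookup-map i proj₁ u) (lookup-map i proj₁ v)) eq)

  base-distinct : ∀ {u v} → u ∈ₗ ys → v ∈ₗ ys → u ≢ v → base u ≢ base v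
  base-distinct {u} {v} u∈ v∈ u≢v eq
    with i , d ← differ {u} {v} u∈ v∈ u≢v (suc zero)
    with () ← trans (sym d) (trans (lookup-zipWith _⊖_ i (base u) (base v))
                (trans (cong (λ w → lookup w i ⊖ lookup (base v) i) eq) (⊖-self (lookup (base v) i))))

  covering : Covering (List.map base ys)
  covering {u} {v} u∈ v∈ u≢v a _
    with u′ , u′∈ , refl ← ∈-map⁻ base u∈ | v′ , v′∈ , refl ← ∈-map⁻ base v∈
    = differ {u′} {v′} u′∈ v′∈ (u≢v ∘ cong base) a

-- Monotonicity in q and the binary case.

-- A constant extra coordinate preserves both distinctness and covering.
R-suc : ∀ s q → R (suc s) q ≤ R (suc s) (suc q)
R-suc s q with F , F! , cov , eq ← R-attained (suc s) q = begin
  R (suc s) q                    ≡⟨ eq ⟨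
  length F                       ≡⟨ length-map (zero ∷_) F ⟨
  length (List.map (zero ∷_) F)  ≤⟨ length≤R (List.map (zero ∷_) F)
      (Unique.map⁺ ∷-injectiveʳ F!) (λ {u} {v} → cov′ {u} {v}) ⟩
  R (suc s) (suc q)              ∎
  where
  open ≤-Reasoning
  cov′ : Covering (List.map (zero ∷_) F)
  cov′ u∈ v∈ u≢v a a∈
    with u′ , u′∈ , refl ← ∈-map⁻ (zero ∷_) u∈ | v′ , v′∈ , refl ← ∈-map⁻ (zero ∷_) v∈
    with i , e ← cov u′∈ v′∈ (u≢v ∘ cong (zero ∷_)) a a∈ = suc i , e

R-mono : ∀ s {q q′} → q ≤ q′ → R (suc s) q ≤ R (suc s) q′
R-mono s {q} {q′} q≤q′ = subst (λ z → R (suc s) q ≤ R (suc s) z) (m∸n+n≡m q≤q′) (go (q′ ∸ q))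
  where
  go : ∀ k → R (suc s) q ≤ R (suc s) (k + q)
  go zero    = ≤-refl
  go (suc k) = ≤-trans (go k) (R-suc s (k + q))

-- Fixing the first bit of all binary vectors supplies the difference 0 there; any other bit that
-- differs supplies 1.
R-binary : ∀ q → R 2 (suc q) ≥ 2 ^ q
R-binary q = begin
  2 ^ q                           ≡⟨ length-vectors (allFin 2) q ⟨
  length V                        ≡⟨ length-map (zero ∷_) V ⟨
  length (List.map (zero ∷_) V)   ≤⟨ length≤R (List.map (zero ∷_) V)
      (Unique.map⁺ ∷-injectiveʳ (vectors-unique (Unique.allFin⁺ 2) q)) (λ {u} {v} → cov {u} {v}) ⟩
  R 2 (suc q)                     ∎
  where
  open ≤-Reasoning
  V = vectors (allFin 2) q

  distinct-bits : ∀ (x y : Fin 2) → x ≢ y → x ⊖ y ≡ suc zero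
  distinct-bits zero       zero       ne = ⊥-elim (ne refl)
  distinct-bits zero       (suc zero) ne = refl
  distinct-bits (suc zero) zero       ne = refl
  distinct-bits (suc zero) (suc zero) ne = ⊥-elim (ne refl)

  cov : Covering (List.map (zero ∷_) V)
  cov u∈ v∈ u≢v a a∈
    with u , _ , refl ← ∈-map⁻ (zero ∷_) u∈ | v , _ , refl ← ∈-map⁻ (zero ∷_) v∈ = go a
    where
    go : ∀ a → ∃ λ i → lookup ((zero ∷ u) ⊟ (zero ∷ v)) i ≡ a
    go zero       = zero , refl
    go (suc zero) with i , ne ← distinct⇒somewhere Fin._≟_ u v (u≢v ∘ cong (zero ∷_))
      = suc i , trans (lookup-zipWith _⊖_ i u v) (distinct-bits (lookup u i) (lookup v i) ne)

-- Growth estimates for powers.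

^-distribʳ-* : ∀ m n o → (m * n) ^ o ≡ m ^ o * n ^ o
^-distribʳ-* m n zero    = refl
^-distribʳ-* m n (suc o) rewrite ^-distribʳ-* m n o = lemma m n (m ^ o) (n ^ o)
  where
  lemma : ∀ a b c d → a * b * (c * d) ≡ a * c * (b * d)
  lemma = solve-∀

^-swap : ∀ m n o → (m ^ n) ^ o ≡ m ^ (o * n)
^-swap m n o = trans (^-*-assoc m n o) (cong (m ^_) (*-comm n o))

-- Bernoulli's inequality (1 + 1/m)^n ≥ 1 + n/m, cleared of denominators.
bernoulli : ∀ m n → m ^ n * (m + n) ≤ m * suc m ^ n
bernoulli m zero    = ≤-reflexive (lemma m)
  where
  lemma : ∀ m → 1 * (m + 0) ≡ m * 1
  lemma = solve-∀
bernoulli m (suc n) = begin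
  m * m ^ n * (m + suc n)                      ≤⟨ m≤m+n _ (m ^ n * n) ⟩
  m * m ^ n * (m + suc n) + m ^ n * n          ≡⟨ lemma₁ m n (m ^ n) ⟩
  suc m * (m ^ n * (m + n))                    ≤⟨ *-monoʳ-≤ (suc m) (bernoulli m n) ⟩
  suc m * (m * suc m ^ n)                      ≡⟨ lemma₂ m (suc m ^ n) ⟩
  m * (suc m * suc m ^ n)                      ∎
  where
  open ≤-Reasoning
  lemma₁ : ∀ m n x → m * x * (m + (1 + n)) + x * n ≡ (1 + m) * (x * (m + n))
  lemma₁ = solve-∀
  lemma₂ : ∀ m x → (1 + m) * (m * x) ≡ m * ((1 + m) * x)
  lemma₂ = solve-∀

geometric : ∀ {x y} c → x < y → ∀ {n} → c * x < n → c * x ^ n ≤ y ^ n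
geometric {zero}  {y} c _   {suc n} _    = ≤-trans (≤-reflexive (*-zeroʳ c)) z≤n
geometric {suc x} {y} c x<y {n}     cx<n = *-cancelˡ-≤ (suc x) (begin
  suc x * (c * suc x ^ n)          ≡⟨ lemma (suc x) c (suc x ^ n) ⟩
  suc x ^ n * (c * suc x)          ≤⟨ *-monoʳ-≤ (suc x ^ n) (≤-trans (<⇒≤ cx<n) (m≤n+m n (suc x))) ⟩
  suc x ^ n * (suc x + n)          ≤⟨ bernoulli (suc x) n ⟩
  suc x * suc (suc x) ^ n          ≤⟨ *-monoʳ-≤ (suc x) (^-monoˡ-≤ n x<y) ⟩
  suc x * y ^ n                    ∎)
  where
  open ≤-Reasoning
  lemma : ∀ x c z → x * (c * z) ≡ z * (c * x)
  lemma = solve-∀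

n<2^n : ∀ n → n < 2 ^ n
n<2^n zero    = s≤s z≤n
n<2^n (suc n) = begin-strict
  suc n               ≡⟨ +-comm 1 n ⟩
  n + 1               <⟨ +-mono-<-≤ (n<2^n n) (m^n>0 2 n) ⟩
  2 ^ n + 2 ^ n       ≡⟨ cong (λ z → 2 ^ n + z) (+-identityʳ _) ⟨
  2 ^ n + (2 ^ n + 0) ∎
  where open ≤-Reasoning

-- Both sides compare with (2m + 1)², because 2m + 1 ≤ 2^(2m).
linear≤exponential : ∀ m → suc (4 * m * m) ≤ 2 ^ (4 * m)
linear≤exponential m = begin
  suc (4 * m * m)            ≤⟨ m≤m+n _ (4 * m) ⟩
  suc (4 * m * m) + 4 * m    ≡⟨ lemma₁ m ⟩
  suc (2 * m) * suc (2 * m)  ≤⟨ *-mono-≤ (n<2^n (2 * m)) (n<2^n (2 * m)) ⟩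
  2 ^ (2 * m) * 2 ^ (2 * m)  ≡⟨ ^-distribˡ-+-* 2 (2 * m) (2 * m) ⟨
  2 ^ (2 * m + 2 * m)        ≡⟨ cong (2 ^_) (lemma₂ m) ⟩
  2 ^ (4 * m)                ∎
  where
  open ≤-Reasoning
  lemma₁ : ∀ m → (1 + 4 * m * m) + 4 * m ≡ (1 + 2 * m) * (1 + 2 * m)
  lemma₁ = solve-∀
  lemma₂ : ∀ m → 2 * m + 2 * m ≡ 4 * m
  lemma₂ = solve-∀

linear-geometric : ∀ {x y} → x < y → ∃ λ n → 0 < n × suc n * x ^ n ≤ y ^ n
-- The choice of `m` gives 2 x^m ≤ y^m. Taken 4m times, this gains 2^(4m), which beats the linear
-- factor at n = 4m².
linear-geometric {x} {y} x<y = 4 * m * m , s≤s z≤n , (begin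
  suc (4 * m * m) * x ^ (4 * m * m)    ≤⟨ *-monoˡ-≤ (x ^ (4 * m * m)) (linear≤exponential m) ⟩
  2 ^ (4 * m) * x ^ (4 * m * m)        ≡⟨ cong (2 ^ (4 * m) *_) (^-swap x m (4 * m)) ⟨
  2 ^ (4 * m) * (x ^ m) ^ (4 * m)      ≡⟨ ^-distribʳ-* 2 (x ^ m) (4 * m) ⟨
  (2 * x ^ m) ^ (4 * m)                ≤⟨ ^-monoˡ-≤ (4 * m) (geometric 2 x<y (n<1+n (2 * x))) ⟩
  (y ^ m) ^ (4 * m)                    ≡⟨ ^-swap y m (4 * m) ⟩
  y ^ (4 * m * m)                      ∎)
  where
  open ≤-Reasoning
  m = suc (2 * x)

power-rate : ∀ {K r n p} k → K * r ^ n ≤ p ^ n → K ^ k * r ^ (k * n) ≤ p ^ (k * n)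
power-rate {K} {r} {n} {p} k rate = begin
  K ^ k * r ^ (k * n)   ≡⟨ cong (K ^ k *_) (^-swap r n k) ⟨
  K ^ k * (r ^ n) ^ k   ≡⟨ ^-distribʳ-* K (r ^ n) k ⟨
  (K * r ^ n) ^ k       ≤⟨ ^-monoˡ-≤ k rate ⟩
  (p ^ n) ^ k           ≡⟨ ^-swap p n k ⟩
  p ^ (k * n)           ∎
  where open ≤-Reasoning

-- One colour more than there are blocks is negligible for many blocks.
chain-rate : ∀ {n K r p p′ r′} → 0 < r′ → 0 < n → K * r′ ^ n ≤ p′ ^ n → p′ * r < p * r′ →
  ∃ λ k → 0 < k × K ^ suc k * r ^ (k * n) ≤ p ^ (k * n)
chain-rate {n} {K} {r} {p} {p′} {r′} 0<r′ 0<n rate p′r<pr′ = k , s≤s z≤n ,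
  *-cancelʳ-≤ _ _ (r′ ^ (k * n)) {{m^n≢0 r′ (k * n) {{>-nonZero 0<r′}}}} (begin
    K * K ^ k * r ^ (k * n) * r′ ^ (k * n)     ≡⟨ lemma₁ K (K ^ k) (r ^ (k * n)) (r′ ^ (k * n)) ⟩
    K * (K ^ k * r′ ^ (k * n) * r ^ (k * n))   ≤⟨ *-monoʳ-≤ K (*-monoˡ-≤ (r ^ (k * n))
                                                    (power-rate {K} {r′} {n} {p′} k rate)) ⟩
    K * (p′ ^ (k * n) * r ^ (k * n))           ≡⟨ cong (K *_) (^-distribʳ-* p′ r (k * n)) ⟨
    K * (p′ * r) ^ (k * n)                     ≡⟨ cong (K *_) (^-swap (p′ * r) n k) ⟨
    K * ((p′ * r) ^ n) ^ k                     ≤⟨ geometric K (^-monoˡ-< n {{>-nonZero 0<n}} p′r<pr′)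
                                                    (n<1+n (K * (p′ * r) ^ n)) ⟩
    ((p * r′) ^ n) ^ k                         ≡⟨ ^-swap (p * r′) n k ⟩
    (p * r′) ^ (k * n)                         ≡⟨ ^-distribʳ-* p r′ (k * n) ⟩
    p ^ (k * n) * r′ ^ (k * n)                 ∎)
  where
  open ≤-Reasoning
  -- The threshold of `geometric` for the base (p′ r)^n and the factor `K`.
  k = suc (K * (p′ * r) ^ n)
  lemma₁ : ∀ a b c d → a * b * c * d ≡ a * (b * d * c)
  lemma₁ = solve-∀

-- Numbers of colours per letter arbitrarily close to s.

-- For positive r, the number of colours per letter, K^(1/n), is at most p/r.
Achievable : List (Fin s) → ℕ → ℕ → Set
Achievable as p r = ∃ λ n → ∃ λ K → 0 < n × Colouring (DifferAll {n = n} as) K × K * r ^ n ≤ p ^ n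

AchievableOne : Fin s → ℕ → ℕ → Set
AchievableOne a p r = ∃ λ n → ∃ λ K → 0 < n × Colouring (Differ {n = n} a) K × K * r ^ n ≤ p ^ n

-- `edgeColouring` spends s colours per letter up to a factor linear in n, which any gap between s
-- and p/r absorbs for suitable n.
edge-rate : ∀ (a : Fin s) {p r} → s * r < p → AchievableOne a p r
edge-rate {s} a {p} {r} sr<p with n , 0<n , rate ← linear-geometric sr<p
  = n , s ^ n * suc n , 0<n , edgeColouring a n , (begin
    s ^ n * suc n * r ^ n     ≡⟨ lemma (s ^ n) (suc n) (r ^ n) ⟩
    suc n * (s ^ n * r ^ n)   ≡⟨ cong (suc n *_) (^-distribʳ-* s r n) ⟨
    suc n * (s * r) ^ n       ≤⟨ rate ⟩
    p ^ n                     ∎)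
  where
  open ≤-Reasoning
  lemma : ∀ a b c → a * b * c ≡ b * (a * c)
  lemma = solve-∀

powerDiffer : ∀ {a : Fin s} k → Colouring (Differ {n = n} a) K → Colouring (Differ {n = k * n} a) (K ^ k)
powerDiffer {a = a} k c = flatten (λ {u} {v} → differ-concat a {u} {v}) (power (≡-dec _≟ₗ_) k c)

-- Powers bring both colourings to the common length n₁ n₂, and the larger number of colours serves
-- both. Chaining them then costs only the step from p′/r′ up to p/r.
combine-rates : ∀ {a} {as : List (Fin (suc s))} {p r p′ r′} → 0 < r′ → p′ * r < p * r′ →
  Achievable as p′ r′ → AchievableOne a p′ r′ → Achievable (a ∷ as) p r
combine-rates {s} {a} {as} {p} {r} {p′} {r′} 0<r′ p′r<pr′
  (n₁ , K₁ , 0<n₁ , c₁ , rate₁) (n₂ , K₂ , 0<n₂ , c₂ , rate₂) =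
  let k , 0<k , rate′ = chain-rate {n = m} {L} {r} {p} {p′} {r′} 0<r′ 0<m rate p′r<pr′ in
  k * m , L ^ suc k , *-mono-< 0<k 0<m , chainWords k c₁′ c₂′ , rate′
  where
  m L : ℕ
  m = n₂ * n₁
  L = K₁ ^ n₂ ⊔ K₂ ^ n₁
  0<m : 0 < m
  0<m = *-mono-< 0<n₂ 0<n₁
  c₁′ : Colouring (DifferAll {n = m} as) L
  c₁′ = weaken (m≤m⊔n (K₁ ^ n₂) (K₂ ^ n₁)) (powerWords n₂ c₁)
  c₂′ : Colouring (Differ {n = m} a) L
  c₂′ = weaken (m≤n⊔m (K₁ ^ n₂) (K₂ ^ n₁))
    (subst (λ m → Colouring (Differ {n = m} a) (K₂ ^ n₁)) (*-comm n₁ n₂) (powerDiffer n₁ c₂))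
  rate : L * r′ ^ m ≤ p′ ^ m
  rate = begin
    (K₁ ^ n₂ ⊔ K₂ ^ n₁) * r′ ^ m              ≡⟨ *-distribʳ-⊔ (r′ ^ m) (K₁ ^ n₂) (K₂ ^ n₁) ⟩
    K₁ ^ n₂ * r′ ^ m ⊔ K₂ ^ n₁ * r′ ^ m       ≤⟨ ⊔-lub
      (power-rate {K₁} {r′} {n₁} {p′} n₂ rate₁)
      (subst (λ m → K₂ ^ n₁ * r′ ^ m ≤ p′ ^ m) (*-comm n₁ n₂) (power-rate {K₂} {r′} {n₂} {p′} n₁ rate₂)) ⟩
    p′ ^ m                                    ∎
    where open ≤-Reasoning

-- No residues need only one colour. Each further residue uses up half of the excess of p/r over the
-- modulus, so some excess always remains.
achievable : ∀ (as : List (Fin (suc s))) {p r} → 0 < r → suc s * r < p → Achievable as p r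
achievable {s} [] {p} {r} 0<r sr<p =
  1 , 1 , s≤s z≤n , record { colour = λ _ → zero ; separates = λ _ _ → [] } , (begin
  1 * (r * 1)       ≡⟨ *-identityˡ (r * 1) ⟩
  r * 1             ≤⟨ *-monoˡ-≤ 1 (≤-trans (m≤m+n r (s * r)) (<⇒≤ sr<p)) ⟩
  p * 1             ∎)
  where open ≤-Reasoning
achievable {s} (a ∷ as) {p} {r} 0<r sr<p =
  combine-rates 0<r′ p′r<pr′ (achievable as 0<r′ sr′<p′) (edge-rate a sr′<p′)
  where
  -- p′/r′ is the midpoint of s and p/r.
  p′ r′ : ℕ
  p′ = p + suc s * r
  r′ = 2 * r
  0<r′ : 0 < r′
  0<r′ = ≤-trans 0<r (m≤m+n r _)
  sr′<p′ : suc s * r′ < p′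
  sr′<p′ = begin-strict
    suc s * (2 * r)          ≡⟨ lemma (suc s) r ⟩
    suc s * r + suc s * r    <⟨ +-monoˡ-< (suc s * r) sr<p ⟩
    p + suc s * r            ∎
    where
    open ≤-Reasoning
    lemma : ∀ s r → s * (2 * r) ≡ s * r + s * r
    lemma = solve-∀
  p′r<pr′ : p′ * r < p * r′
  p′r<pr′ = begin-strict
    (p + suc s * r) * r       ≡⟨ *-distribʳ-+ r p (suc s * r) ⟩
    p * r + suc s * r * r     <⟨ +-monoʳ-< (p * r) (*-monoˡ-< r {{>-nonZero 0<r}} sr<p) ⟩
    p * r + p * r             ≡⟨ lemma p r ⟩
    p * (2 * r)               ∎
    where
    open ≤-Reasoning
    lemma : ∀ p r → p * r + p * r ≡ p * (2 * r)
    lemma = solve-∀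

-- From rates to lower bounds for all large q.

-- At multiples N of n, the largest colour class gives `R` at least (2 (2 + s) r/p)^N, whose base
-- exceeds a/b. The surplus also pays for rounding q down to such an N.
achievable⇒R : ∀ s a b {p r} → 0 < b → 0 < p → a * p < (2 + s) * 2 * (r * b) →
  Achievable (allFin (2 + s)) p r →
  ∃ λ q₀ → ∀ q → q₀ ≤ q → a ^ q ≤ R (2 + s) q * b ^ q
-- Rounding loses at most n, and the multiple that remains must exceed C x for `geometric`.
achievable⇒R s a b {p} {r} 0<b 0<p x<y (n , K , 0<n , c , rate) = suc (C * x) + n , bound
  where
  open ≤-Reasoning
  instance
    n≢0 = >-nonZero 0<n
    b≢0 = >-nonZero 0<b
    p≢0 = >-nonZero 0<p
  x = a * p
  y = (2 + s) * 2 * (r * b)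
  -- bounds a ^ (q % n), also for a = 0
  C = suc a ^ n

  module _ (k : ℕ) where
    N = k * n
    ρ = R (2 + s) N

    block-bound : C * x < N → C * a ^ N ≤ ρ * b ^ N
    block-bound Cx<N = *-cancelʳ-≤ _ _ (p ^ N) {{m^n≢0 p N}} (begin
      C * a ^ N * p ^ N                            ≡⟨ *-assoc C (a ^ N) (p ^ N) ⟩
      C * (a ^ N * p ^ N)                          ≡⟨ cong (C *_) (^-distribʳ-* a p N) ⟨
      C * x ^ N                                    ≤⟨ geometric C x<y Cx<N ⟩
      y ^ N                                        ≡⟨ ^-distribʳ-* ((2 + s) * 2) (r * b) N ⟩
      ((2 + s) * 2) ^ N * (r * b) ^ N              ≤⟨ *-monoˡ-≤ ((r * b) ^ N) (colouring⇒R (powerWords k c)) ⟩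
      K ^ k * ρ * (r * b) ^ N                      ≡⟨ cong (K ^ k * ρ *_) (^-distribʳ-* r b N) ⟩
      K ^ k * ρ * (r ^ N * b ^ N)                  ≡⟨ lemma₁ (K ^ k) ρ (r ^ N) (b ^ N) ⟩
      ρ * b ^ N * (K ^ k * r ^ N)                  ≤⟨ *-monoʳ-≤ (ρ * b ^ N) (power-rate {K} {r} {n} {p} k rate) ⟩
      ρ * b ^ N * p ^ N                            ∎)
      where
      lemma₁ : ∀ c d e f → c * d * (e * f) ≡ d * f * (c * e)
      lemma₁ = solve-∀

  bound : ∀ q → suc (C * x) + n ≤ q → a ^ q ≤ R (2 + s) q * b ^ q
  bound q q₀≤q = begin
    a ^ q                            ≡⟨ cong (a ^_) q≡ ⟩
    a ^ (q % n + N′)                 ≡⟨ ^-distribˡ-+-* a (q % n) N′ ⟩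
    a ^ (q % n) * a ^ N′             ≤⟨ *-monoˡ-≤ (a ^ N′) (≤-trans (^-monoˡ-≤ (q % n) (n≤1+n a))
                                          (^-monoʳ-≤ (suc a) (<⇒≤ (m%n<n q n)))) ⟩
    C * a ^ N′                       ≤⟨ block-bound (q ÷ n) (+-cancelʳ-≤ n _ _ (begin
        suc (C * x) + n   ≤⟨ q₀≤q ⟩
        q                 ≡⟨ q≡ ⟩
        q % n + N′        ≤⟨ +-monoˡ-≤ N′ (<⇒≤ (m%n<n q n)) ⟩
        n + N′            ≡⟨ +-comm n N′ ⟩
        N′ + n            ∎)) ⟩
    R (2 + s) N′ * b ^ N′            ≤⟨ *-mono-≤ (R-mono (suc s) N′≤q) (^-monoʳ-≤ b N′≤q) ⟩
    R (2 + s) q * b ^ q              ∎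
    where
    N′ = N (q ÷ n)
    q≡ : q ≡ q % n + N′
    q≡ = m≡m%n+[m/n]*n q n
    N′≤q : N′ ≤ q
    N′≤q = ≤-trans (m≤n+m N′ (q % n)) (≤-reflexive (sym q≡))

R-lower : ∀ s a b → 0 < b → a < 2 * b → ∃ λ q₀ → ∀ q → q₀ ≤ q → a ^ q ≤ R (2 + s) q * b ^ q
R-lower s a b 0<b a<2b = achievable⇒R s a b 0<b (≤-trans (s≤s z≤n) sr<p) ap<2srb
  (achievable (allFin (2 + s)) {p} {r} (s≤s z≤n) sr<p)
  where
  -- p/(s r) lies strictly between 1 and 2 b/a.
  p r : ℕ
  p = (2 + s) * (2 * b + suc a)
  r = suc (2 * a)

  open ≤-Reasoning

  sr<p : (2 + s) * r < p
  sr<p = *-monoʳ-< (2 + s) (begin-strict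
    suc (2 * a)     ≡⟨ lemma a ⟩
    a + suc a       <⟨ +-monoˡ-< (suc a) a<2b ⟩
    2 * b + suc a   ∎)
    where
    lemma : ∀ a → 1 + 2 * a ≡ a + (1 + a)
    lemma = solve-∀

  ap<2srb : a * p < (2 + s) * 2 * (r * b)
  ap<2srb = begin-strict
    a * p                                      ≡⟨ lemma₁ (2 + s) a b ⟩
    (2 + s) * (2 * (a * b) + a * suc a)        <⟨ *-monoʳ-< (2 + s)
                                                    (+-monoʳ-< (2 * (a * b)) (*-monoˡ-< (suc a) a<2b)) ⟩
    (2 + s) * (2 * (a * b) + 2 * b * suc a)    ≡⟨ lemma₂ (2 + s) a b ⟩
    (2 + s) * 2 * (r * b)                      ∎
    where
    lemma₁ : ∀ s a b → a * (s * (2 * b + (1 + a))) ≡ s * (2 * (a * b) + a * (1 + a))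
    lemma₁ = solve-∀
    lemma₂ : ∀ s a b → s * (2 * (a * b) + 2 * b * (1 + a)) ≡ s * 2 * ((1 + 2 * a) * b)
    lemma₂ = solve-∀

-- Translation to rational numbers.

-- Unnormalised, so that powers act on numerator and denominator without cancelling common factors.
fraction : ∀ a b → .{{NonZero b}} → ℚᵘ.ℚᵘ
fraction a b = + a ℚᵘ./ b

fraction-* : ∀ a b c d .{{_ : NonZero b}} .{{_ : NonZero d}} .{{_ : NonZero (b * d)}} →
  fraction a b ℚᵘ.* fraction c d ≡ fraction (a * c) (b * d)
fraction-* a (suc b) c (suc d) = cong (λ z → ℚᵘ.mkℚᵘ z (d + b * suc d)) (sym (ℤ.pos-* a c))

^ℚ-fraction : ∀ (x : ℚ) a b .{{_ : NonZero b}} → ℚ.toℚᵘ x ≡ fraction a b →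
  ∀ q .{{_ : NonZero (b ^ q)}} → ℚ.toℚᵘ (x ^ℚ q) ℚᵘ.≃ fraction (a ^ q) (b ^ q)
^ℚ-fraction x a b eq zero    = ℚᵘ.≃-refl
^ℚ-fraction x a b eq (suc q) = begin
  ℚ.toℚᵘ (x ℚ.* x ^ℚ q)                   ≈⟨ ℚ.toℚᵘ-homo-* x (x ^ℚ q) ⟩
  ℚ.toℚᵘ x ℚᵘ.* ℚ.toℚᵘ (x ^ℚ q)           ≈⟨ ℚᵘ.*-cong (ℚᵘ.≃-reflexive eq) (^ℚ-fraction x a b eq q) ⟩
  fraction a b ℚᵘ.* fraction (a ^ q) (b ^ q)  ≡⟨ fraction-* a b (a ^ q) (b ^ q) ⟩
  fraction (a ^ suc q) (b ^ suc q)        ∎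
  where
  open ℚᵘ.≃-Reasoning
  instance b^q≢0 = m^n≢0 b q

fraction-≤ : ∀ a b c .{{_ : NonZero b}} → a ≤ c * b → fraction a b ℚᵘ.≤ fraction c 1
fraction-≤ a (suc b) c a≤cb = ℚᵘ.*≤* (subst₂ ℤ._≤_
  (sym (ℤ.*-identityʳ (+ a))) (ℤ.pos-* c (suc b)) (ℤ.+≤+ a≤cb))

^ℚ-≤ : ∀ (x : ℚ) a b ρ q .{{_ : NonZero b}} → ℚ.toℚᵘ x ≡ fraction a b →
  a ^ q ≤ ρ * b ^ q → x ^ℚ q ≤ℚ + ρ / 1
^ℚ-≤ x a b ρ q eq a^q≤ = ℚ.toℚᵘ-cancel-≤ (begin
  ℚ.toℚᵘ (x ^ℚ q)               ≃⟨ ^ℚ-fraction x a b eq q ⟩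
  fraction (a ^ q) (b ^ q)      ≤⟨ fraction-≤ (a ^ q) (b ^ q) ρ a^q≤ ⟩
  fraction ρ 1                  ≃⟨ ℚ.toℚᵘ-fromℚᵘ (fraction ρ 1) ⟨
  ℚ.toℚᵘ (+ ρ / 1)              ∎)
  where
  open ℚᵘ.≤-Reasoning
  instance b^q≢0 = m^n≢0 b q

0≤2-δ : ∀ δ → δ ≤ℚ + 2 / 1 → 0ℚ ≤ℚ (+ 2 / 1) - δ
0≤2-δ δ δ≤2 = subst (_≤ℚ (+ 2 / 1) - δ) (ℚ.+-inverseʳ δ) (ℚ.+-monoˡ-≤ (ℚ.- δ) δ≤2)

2-δ<2 : ∀ δ → 0ℚ <ℚ δ → (+ 2 / 1) - δ <ℚ + 2 / 1
2-δ<2 δ 0<δ = subst ((+ 2 / 1) - δ <ℚ_) (ℚ.+-identityʳ (+ 2 / 1))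
  (ℚ.+-monoʳ-< (+ 2 / 1) (ℚ.neg-antimono-< 0<δ))

-- Numerator and denominator of x serve as a and b in `R-lower`; nonnegativity makes the numerator a
-- natural number.
rate⇒R : ∀ s x → 0ℚ ≤ℚ x → x <ℚ + 2 / 1 → ∃ λ q₀ → ∀ q → q₀ ≤ q → x ^ℚ q ≤ℚ + R (2 + s) q / 1
rate⇒R s x@(ℚ.mkℚ (+ a) b-1 _) _ (ℚ.*<* x<2) =
  let q₀ , bound = R-lower s a (suc b-1) (s≤s z≤n) a<2b in
  q₀ , λ q q₀≤q → ^ℚ-≤ x a (suc b-1) (R (2 + s) q) q refl (bound q q₀≤q)
  where
  a<2b : a < 2 * suc b-1
  a<2b = ℤ.drop‿+<+ (subst₂ ℤ._<_ (ℤ.*-identityʳ (+ a)) (sym (ℤ.pos-* 2 (suc b-1))) x<2)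
rate⇒R s (ℚ.mkℚ -[1+ a ] b-1 _) (ℚ.*≤* ()) _

theorem1p3 : ((∀ (s q : ℕ) → 2 ≤ s → s ≤ q → R s q ≤ 2 ^ (q ∸ 1))
    × (∀ (q : ℕ) → 2 ≤ q → R 2 q ≡ 2 ^ (q ∸ 1)))
    × (∀ (s : ℕ) → 2 ≤ s → ∀ (δ : ℚ) → 0ℚ <ℚ δ → δ ≤ℚ + 2 / 1 →
    ∃ λ (q₀ : ℕ) → ∀ (q : ℕ) → q₀ ≤ q → ((+ 2 / 1) - δ) ^ℚ q ≤ℚ + R s q / 1)
theorem1p3 =
  (R-upper , λ { (suc q) 2≤q → ≤-antisym (R-upper 2 (suc q) (s≤s (s≤s z≤n)) 2≤q) (R-binary q) }) ,
  λ { (suc (suc s)) _ δ 0<δ δ≤2 → rate⇒R s ((+ 2 / 1) - δ) (0≤2-δ δ δ≤2) (2-δ<2 δ 0<δ)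
    ; (suc zero) (s≤s ()) }
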